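{- Let $h$ be a Hessenberg function on $\{1,\dots,n\}$. For $x^\alpha\in\mathcal{B}_h$, let $\Psi_h(x^\alpha)$ be the Level $n$ word of the $h$-tableau-tree lying directly above the leaf labelled $x^\alpha$. Then $\Psi_h$ is a well-defined map from $\mathcal{B}_h$ to the set of $(h,(n))$-fillings, it sends monomials of degree $r$ to fillings with exactly $r$ dimension pairs, and $\Phi(\Psi_h(x^\alpha))=x^\alpha$ for all $x^\alpha\in\mathcal{B}_h$; more precisely, for every $k\in\{2,\dots,n\}$, $|D^{\Psi_h(x^\alpha)}_k|=\alpha_k$.
   Context: A Hessenberg function is $h:\{1,\dots,n\}\to\{1,\dots,n\}$, $h_i=h(i)$, with $i\le h_i$ and $h_i\le h_{i+1}$; degree tuple $\beta_i=i-\#\{k:h_k<i\}$; $\mathcal{B}_h=\{x_1^{\alpha_1}\cdots x_n^{\alpha_n}:0\le\alpha_i\le\beta_i-1\}$. A word $u_1\cdots u_m$ of distinct numbers is $h$-permissible if $u_t\le h(u_{t+1})$ for all $t$; an $(h,(n))$-filling is an $h$-permissible permutation $T=w_1\cdots w_n$ of $1,\dots,n$ in one row. Dimension pairs of such $T$: $(a,b)$ with $b>a$, $b$ appearing to the left of $a$, and, if $a$ is immediately followed by $c$, $b\le h(c)$. $D^T_k$ is the set of dimension pairs $(a,k)$ and $\Phi(T)=\prod_{k=2}^n x_k^{|D^T_k|}$. The $h$-tableau-tree: Level 1 is the word $1$; a vertex at Level $i-1$ is an $h$-permissible word on $\{1,\dots,i-1\}$ whose $\beta_i$ bullet positions are the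 gaps where inserting $i$ keeps it $h$-permissible; its child along edge $x_i^j$ ($0\le j\le\beta_i-1$) inserts $i$ at the $(j+1)$-th bullet from the right. Each Level $n$ word has one leaf child (edge label $1$) labelled by the product of edge labels on its root path. -}

module Defs where

open import Data.Fin.Base using (Fin; toℕ; fromℕ<; _≤_; _<_)
open import Data.Fin.Properties using (_≟_; _≤?_; _<?_; all?)
open import Data.List.Base
  using (List; []; _∷_; length; filter; map; foldr; reverse; allFin;
         insertAt; lookup; cartesianProduct)
open import Data.List.Relation.Binary.Infix.Heterogeneous using (Infix)
open import Data.List.Relation.Binary.Infix.Heterogeneous.Properties using (infix?)
open import Data.List.Relation.Binary.Permutation.Propositional using (_↭_)
import Data.List.Relation.Binary.Sublist.DecPropositional as Sublist
open import Data.List.Relation.Unary.Linked using (Linked; linked?)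
open import Data.Nat.Base as ℕ using (ℕ; zero; suc; _+_; _∸_)
import Data.Nat.Properties as ℕ
open import Data.Product.Base using (_×_; _,_; proj₂; uncurry)
open import Data.Vec.Base as Vec using (Vec; replicate; zipWith; _[_]≔_)
open import Level using (0ℓ)
open import Relation.Binary.PropositionalEquality.Core using (_≡_)
open import Relation.Nullary.Decidable using (Dec; _×-dec_; _→-dec_)
open import Relation.Unary using (Pred)

-- The set {1,…,n} is represented by Fin n; i : Fin n stands for the number
-- val i.  Comparisons between elements of Fin n are unaffected by the shift.

val : ∀ {n} → Fin n → ℕ
val i = suc (toℕ i)

record HessenbergFunction (n : ℕ) : Set where
  field
    h         : Fin n → Fin n
    extensive : ∀ i → i ≤ h i
    monotone  : ∀ i j → val j ≡ suc (val i) → h i ≤ h j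

-- A monomial x₁^α₁ ⋯ xₙ^αₙ is its exponent vector.

Monomial : ℕ → Set
Monomial n = Vec ℕ n

𝟙 : ∀ {n} → Monomial n
𝟙 = replicate _ 0

infixl 7 _·_

_·_ : ∀ {n} → Monomial n → Monomial n → Monomial n
_·_ = zipWith _+_

infix 8 𝕩_^_

𝕩_^_ : ∀ {n} → Fin n → ℕ → Monomial n
𝕩 i ^ j = 𝟙 [ i ]≔ j

degree : ∀ {n} → Monomial n → ℕ
degree = Vec.sum

Word : ℕ → Set
Word n = List (Fin n)

module _ {n : ℕ} (H : HessenbergFunction n) where
  open HessenbergFunction H

  -- The subtraction never truncates: h k < i forces k < i, so β i ≥ 1.
  β : Fin n → ℕ
  β i = val i ∸ length (filter (λ k → h k <? i) (allFin n))

  -- As β i ≥ 1, the condition αᵢ ≤ β i − 1 is αᵢ < β i.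
  𝓑 : Pred (Monomial n) 0ℓ
  𝓑 α = ∀ i → Vec.lookup α i ℕ.< β i

  -- Distinctness of the letters is not part of this predicate: it is forced
  -- by _↭_ in IsFilling, and by construction for the words of the tree.
  Permissible : Pred (Word n) 0ℓ
  Permissible = Linked (λ u v → u ≤ h v)

  permissible? : ∀ w → Dec (Permissible w)
  permissible? = linked? (λ u v → u ≤? h v)

  IsFilling : Pred (Word n) 0ℓ
  IsFilling T = Permissible T × T ↭ allFin n

  private module S = Sublist (_≟_ {n})

  -- "b appears to the left of a" is the sublist relation, and "a is
  -- immediately followed by c" is the infix (contiguous sublist) relation.
  IsDimensionPair : Word n → Fin n → Fin n → Set
  IsDimensionPair T a b =
    a < b ×
    (b ∷ a ∷ []) S.⊆ T ×
    (∀ c → Infix _≡_ (a ∷ c ∷ []) T → b ≤ h c)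

  isDimensionPair? : ∀ T a b → Dec (IsDimensionPair T a b)
  isDimensionPair? T a b =
    a <? b ×-dec
    (b ∷ a ∷ []) S.⊆? T ×-dec
    all? (λ c → infix? _≟_ (a ∷ c ∷ []) T →-dec b ≤? h c)

  -- Finite sets of pairs are duplicate-free lists, so that cardinality is
  -- length.
  dimensionPairs : Word n → List (Fin n × Fin n)
  dimensionPairs T =
    filter (uncurry (isDimensionPair? T)) (cartesianProduct (allFin n) (allFin n))

  D : Word n → Fin n → List (Fin n × Fin n)
  D T k = filter (λ p → proj₂ p ≟ k) (dimensionPairs T)

  Φ : Word n → Monomial n
  Φ T = foldr _·_ 𝟙
    (map (λ k → 𝕩 k ^ length (D T k)) (filter (λ k → 2 ℕ.≤? val k) (allFin n)))

  -- A gap of w is given by the number of letters to its left, as in insertAt.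
  -- The gaps are listed from right to left, so the (j+1)-th bullet from the
  -- right has index j.
  bullets : Fin n → (w : Word n) → List (Fin (suc (length w)))
  bullets i w =
    filter (λ g → permissible? (insertAt w g i)) (reverse (allFin (suc (length w))))

  -- Vertex l is the type of vertices of the tree at Level l.  In child, the
  -- letter fromℕ< l<n is the number l + 1, and j is the exponent on the edge;
  -- the last argument says that the (j+1)-th bullet from the right exists.
  mutual
    data Vertex : ℕ → Set where
      root  : .(0<n : 0 ℕ.< n) → Vertex 1
      child : ∀ {l} .(l<n : l ℕ.< n) (v : Vertex l) (j : Fin (β (fromℕ< l<n))) →
              .(toℕ j ℕ.< length (bullets (fromℕ< l<n) (word v))) →
              Vertex (suc l)

    word : ∀ {l} → Vertex l → Word n
    word (root 0<n)            = fromℕ< 0<n ∷ []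
    word (child l<n v j j<len) =
      insertAt (word v) (lookup (bullets i (word v)) (fromℕ< j<len)) i
      where
      i : Fin n
      i = fromℕ< l<n

  pathProduct : ∀ {l} → Vertex l → Monomial n
  pathProduct (root _)          = 𝟙
  pathProduct (child l<n v j _) = pathProduct v · 𝕩 fromℕ< l<n ^ toℕ j

  data Leaf : Set where
    below : Vertex n → Leaf

  wordAbove : Leaf → Word n
  wordAbove (below v) = word v

  leafLabel : Leaf → Monomial n
  leafLabel (below v) = pathProduct v · 𝟙

{-# OPTIONS --safe #-}

-- Let w be a permissible word on 1,…,i−1.  The letter i fits at the right end of
-- w and before each letter v with i ≤ h v, and nowhere else; this gives β i
-- bullets.  A letter a to the right of the inserted i forms a dimension pair
-- (a , i) exactly when the gap just after a was a bullet, so inserting i at the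
-- (j+1)-th bullet from the right creates j pairs (_ , i).  A letter m inserted
-- later affects no dimension pair (a , b) with b < m: if m lands between a and c,
-- then b < m ≤ h c and b < m ≤ h m, so the condition on the successor of a holds
-- both before and after.  Hence |D_k| is the exponent of x_k on the root path.

module Submission where

open import Defs
open import Data.Nat.Base using (ℕ; NonZero; _≤_)
open import Data.Fin.Base using (Fin)
open import Data.List.Base using (length)
open import Data.Product using (∃; ∃!; _×_; proj₁)
open import Data.Vec.Base using (lookup)
open import Relation.Binary.PropositionalEquality using (_≡_)

open import Data.Bool.Base using (if_then_else_)
open import Data.Empty using (⊥-elim)
open import Data.Fin.Base as F using (zero; suc; toℕ; fromℕ<)
import Data.Fin.Properties as F
open import Data.List.Base as L
  using (List; []; _∷_; [_]; _++_; map; filter; foldr; reverse; tabulate; allFin; insertAt;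
         cartesianProduct)
import Data.List.Properties as L
open import Data.List.Membership.Propositional using (_∈_; _∉_)
open import Data.List.Membership.Propositional.Properties
open import Data.List.Membership.Propositional.Properties.WithK using (unique∧set⇒bag)
open import Data.List.Relation.Binary.BagAndSetEquality using (∼bag⇒↭)
open import Data.List.Relation.Binary.Infix.Heterogeneous using (Infix; here; there; _++ⁱ_)
open import Data.List.Relation.Binary.Permutation.Propositional
  using (_↭_; ↭-refl; ↭-sym; ↭-trans; ↭-swap; prep; ↭⇒↭ₛ)
open import Data.List.Relation.Binary.Permutation.Propositional.Properties
  using (∈-resp-↭; ↭-length)
import Data.List.Relation.Binary.Permutation.Setoid.Properties as Permₛ
open import Data.List.Relation.Binary.Prefix.Heterogeneous using ([]; _∷_)
open import Data.List.Relation.Binary.Sublist.Propositional as Sublist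
  using (_⊆_; []; _∷_; _∷ʳ_; ⊆-refl; ⊆-trans; from∈)
import Data.List.Relation.Binary.Sublist.Propositional.Properties as Sublist
open import Data.List.Relation.Unary.All as All using (All; []; _∷_)
open import Data.List.Relation.Unary.AllPairs using ([]; _∷_)
open import Data.List.Relation.Unary.Any using (here; there)
open import Data.List.Relation.Unary.Linked as Linked using (Linked; []; [-]; _∷_)
open import Data.List.Relation.Unary.Unique.Propositional using (Unique)
import Data.List.Relation.Unary.Unique.Propositional.Properties as Unique
open import Data.Nat.Base as ℕ using (_+_; _∸_; s≤s)
import Data.Nat.Properties as ℕ
open import Data.Product.Base using (∃₂; _,_; proj₂; uncurry)
open import Data.Sum.Base using (_⊎_; inj₁; inj₂)
open import Data.Vec.Base as Vec using ()
import Data.Vec.Properties as Vec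
open import Function.Base using (id; _∘_; case_of_)
open import Function.Bundles using (_⇔_; mk⇔; Equivalence)
open import Level using (0ℓ)
open import Relation.Binary.Core using (Rel)
open import Relation.Binary.PropositionalEquality
  using (_≢_; refl; sym; trans; cong; cong₂; subst; setoid; module ≡-Reasoning)
open import Relation.Nullary using (¬_; does; yes; no; contradiction)
open import Relation.Unary using (Pred; Decidable)

open Equivalence using (to; from)

private
  variable
    A B : Set
    u v x y : A
    xs ys zs : List A

-- Lists

Unique-resp-↭ : xs ↭ ys → Unique xs → Unique ys
Unique-resp-↭ p = Permₛ.Unique-resp-↭ (setoid _) (↭⇒↭ₛ p)

-- Duplicate-free lists stand for finite sets, so comparing cardinalities reduces to comparing
-- membership and then applying `↭-length`.
unique∧set⇒↭ : Unique xs → Unique ys → (∀ {x} → x ∈ xs ⇔ x ∈ ys) → xs ↭ ys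
unique∧set⇒↭ xs! ys! eq = ∼bag⇒↭ (unique∧set⇒bag xs! ys! eq)

insertAt-↭ : ∀ (xs : List A) k x → insertAt xs k x ↭ x ∷ xs
insertAt-↭ xs       zero    x = ↭-refl
insertAt-↭ (y ∷ xs) (suc k) x =
  ↭-trans (prep y (insertAt-↭ xs k x)) (↭-swap y x ↭-refl)

module _ {P : Pred B 0ℓ} (P? : Decidable P) where

  filter-map : ∀ (f : A → B) xs → filter P? (map f xs) ≡ map f (filter (P? ∘ f) xs)
  filter-map f []       = refl
  filter-map f (x ∷ xs) with P? (f x)
  ... | yes _ = cong (f x ∷_) (filter-map f xs)
  ... | no  _ = filter-map f xs

module _ {P : Pred A 0ℓ} (P? : Decidable P) where

  -- The dummy entry `y` has its own type because it will be the gap in front of the letter `x`: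
  -- whether this gap is a bullet depends on `x` alone.
  length-filter-∷ : ∀ x xs {y : B} →
    length (filter P? xs) + length (filter (λ _ → P? x) [ y ]) ≡ length (filter P? (x ∷ xs))
  length-filter-∷ x xs with P? x
  ... | yes _ = ℕ.+-comm _ 1
  ... | no  _ = ℕ.+-identityʳ _

module _ {P Q : Pred A 0ℓ} (P? : Decidable P) (Q? : Decidable Q) where

  length-filter-⊎ : (∀ x → P x → ¬ Q x) → (∀ x → P x ⊎ Q x) → ∀ xs →
                    length (filter P? xs) + length (filter Q? xs) ≡ length xs
  length-filter-⊎ disjoint cover []       = refl
  length-filter-⊎ disjoint cover (x ∷ xs) with P? x | Q? x
  ... | yes p | yes q = contradiction q (disjoint x p)
  ... | yes _ | no  _ = cong ℕ.suc (length-filter-⊎ disjoint cover xs)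
  ... | no  _ | yes _ = trans (ℕ.+-suc _ _) (cong ℕ.suc (length-filter-⊎ disjoint cover xs))
  ... | no ¬p | no ¬q with cover x
  ...   | inj₁ p = contradiction p ¬p
  ...   | inj₂ q = contradiction q ¬q

  filter-[x] : P x ⇔ Q x → filter P? [ x ] ≡ filter Q? [ x ]
  filter-[x] {x} P⇔Q with P? x
  ... | yes p = sym (L.filter-accept Q? (to P⇔Q p))
  ... | no ¬p = sym (L.filter-reject Q? (¬p ∘ from P⇔Q))

-- Gaps are listed from right to left, so the gap in front of a newly prepended letter comes last.
reverse-allFin : ∀ m → reverse (allFin (ℕ.suc m)) ≡ map suc (reverse (allFin m)) ++ [ zero ]
reverse-allFin m = begin
  reverse (zero ∷ tabulate suc)         ≡⟨ L.unfold-reverse zero (tabulate suc) ⟩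
  reverse (tabulate suc) ++ [ zero ]    ≡⟨ cong (λ xs → reverse xs ++ [ zero ]) (L.map-tabulate id suc) ⟨
  reverse (map suc (allFin m)) ++ _     ≡⟨ cong (_++ [ zero ]) (L.reverse-map suc (allFin m)) ⟨
  map suc (reverse (allFin m)) ++ _     ∎
  where open ≡-Reasoning

-- The position enters as a natural number, so that appending lists shifts it by a plain addition.
-- This is the form needed to speak of the bullet with index `j`.
Indexed : (A → ℕ → Set) → List A → Set
Indexed P xs = ∀ J → P (L.lookup xs J) (toℕ J)

Indexed-map : ∀ {P : B → ℕ → Set} (f : A → B) xs →
              Indexed (P ∘ f) xs → Indexed P (map f xs)
Indexed-map f (x ∷ xs) p zero    = p zero
Indexed-map {P = P} f (x ∷ xs) p (suc J) =
  Indexed-map {P = λ y j → P y (ℕ.suc j)} f xs (p ∘ suc) J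

Indexed-++ : ∀ {P : A → ℕ → Set} xs → Indexed P xs →
             Indexed (λ y j → P y (length xs + j)) ys → Indexed P (xs ++ ys)
Indexed-++ []       p q J       = q J
Indexed-++ (x ∷ xs) p q zero    = p zero
Indexed-++ {P = P} (x ∷ xs) p q (suc J) =
  Indexed-++ {P = λ y j → P y (ℕ.suc j)} xs (p ∘ suc) q J

Indexed-filter-[x] : ∀ {P : A → ℕ → Set} {Q : Pred A 0ℓ} (Q? : Decidable Q) →
                     P x 0 → Indexed P (filter Q? [ x ])
Indexed-filter-[x] {x = x} Q? p J with Q? x
Indexed-filter-[x] Q? p zero | yes _ = p

-- Sublists and adjacent pairs under insertion and deletion

⊆-delete : ∀ xs → x ∉ zs → zs ⊆ xs ++ x ∷ ys → zs ⊆ xs ++ ys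
⊆-delete []       x∉zs (_ ∷ʳ p)   = p
⊆-delete []       x∉zs (refl ∷ p) = contradiction (here refl) x∉zs
⊆-delete (y ∷ xs) x∉zs (_ ∷ʳ p)   = y ∷ʳ ⊆-delete xs x∉zs p
⊆-delete (y ∷ xs) x∉zs (refl ∷ p) = refl ∷ ⊆-delete xs (x∉zs ∘ there) p

⊆-insert : ∀ xs → zs ⊆ xs ++ ys → zs ⊆ xs ++ x ∷ ys
⊆-insert xs p = ⊆-trans p (Sublist.++⁺ {as = xs} ⊆-refl (_ ∷ʳ ⊆-refl))

infix⇒∈ : Infix _≡_ (u ∷ zs) xs → u ∈ xs
infix⇒∈ (here (refl ∷ _)) = here refl
infix⇒∈ (there p)         = there (infix⇒∈ p)

linked-infix : ∀ {R : Rel A 0ℓ} → Linked R xs → Infix _≡_ (u ∷ v ∷ []) xs → R u v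
linked-infix (r ∷ _) (here (refl ∷ refl ∷ _)) = r
linked-infix [-]     (there (here ()))
linked-infix (_ ∷ l) (there p)                = linked-infix l p

-- The second alternative covers the one way an adjacency can be broken: `x` lands exactly between
-- `u` and `v`.
infix-insert : ∀ xs → Infix _≡_ (u ∷ v ∷ []) (xs ++ ys) →
               Infix _≡_ (u ∷ v ∷ []) (xs ++ x ∷ ys) ⊎ Infix _≡_ (x ∷ v ∷ []) (xs ++ x ∷ ys)
infix-insert []           p                           = inj₁ (there p)
infix-insert (_ ∷ [])     (here (refl ∷ refl ∷ _))    = inj₂ (there (here (refl ∷ refl ∷ [])))
infix-insert (_ ∷ _ ∷ _)  (here (refl ∷ refl ∷ _))    = inj₁ (here (refl ∷ refl ∷ []))
infix-insert (_ ∷ xs)     (there p) with infix-insert xs p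
... | inj₁ q = inj₁ (there q)
... | inj₂ q = inj₂ (there q)

infix-delete : ∀ xs → u ≢ x → v ≢ x → Infix _≡_ (u ∷ v ∷ []) (xs ++ x ∷ ys) →
               Infix _≡_ (u ∷ v ∷ []) (xs ++ ys)
infix-delete []          u≢x v≢x (here (refl ∷ _))        = contradiction refl u≢x
infix-delete []          u≢x v≢x (there p)                = p
infix-delete (_ ∷ [])    u≢x v≢x (here (_ ∷ refl ∷ _))    = contradiction refl v≢x
infix-delete (_ ∷ _ ∷ _) u≢x v≢x (here (refl ∷ refl ∷ _)) = here (refl ∷ refl ∷ [])
infix-delete (_ ∷ xs)    u≢x v≢x (there p)                = there (infix-delete xs u≢x v≢x p)

infix-++⁻ʳ : ∀ xs → u ∉ xs → Infix _≡_ (u ∷ zs) (xs ++ ys) → Infix _≡_ (u ∷ zs) ys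
infix-++⁻ʳ []       u∉xs p                 = p
infix-++⁻ʳ (_ ∷ xs) u∉xs (here (refl ∷ _)) = contradiction (here refl) u∉xs
infix-++⁻ʳ (_ ∷ xs) u∉xs (there p)         = infix-++⁻ʳ xs (u∉xs ∘ there) p

⊆-++⁻ʳ : ∀ xs → x ∉ xs → x ∷ zs ⊆ xs ++ ys → x ∷ zs ⊆ ys
⊆-++⁻ʳ []       x∉xs p          = p
⊆-++⁻ʳ (_ ∷ xs) x∉xs (_ ∷ʳ p)   = ⊆-++⁻ʳ xs (x∉xs ∘ there) p
⊆-++⁻ʳ (_ ∷ xs) x∉xs (refl ∷ _) = contradiction (here refl) x∉xs

Unique-++⁻ʳ : ∀ (xs : List A) {ys} → Unique (xs ++ ys) → Unique ys
Unique-++⁻ʳ []       u       = u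
Unique-++⁻ʳ (x ∷ xs) (_ ∷ u) = Unique-++⁻ʳ xs u

Unique-++⁻-disjoint : ∀ (xs : List A) {ys} → Unique (xs ++ ys) → x ∈ ys → x ∉ xs
Unique-++⁻-disjoint (x ∷ xs) (x∉ ∷ _) x∈ys (here refl) = All.lookup x∉ (∈-++⁺ʳ xs x∈ys) refl
Unique-++⁻-disjoint (x ∷ xs) (_ ∷ u)  x∈ys (there x∈)  = Unique-++⁻-disjoint xs u x∈ys x∈

-- Entries whose successor satisfies a predicate

module _ {P : Pred A 0ℓ} (P? : Decidable P) where

  -- The last entry is always kept: a condition on its successor is vacuous, just as the gap at the
  -- right end of a word is always a bullet.
  beforeSelected : List A → List A
  beforeSelected []           = []
  beforeSelected (x ∷ [])     = [ x ]
  beforeSelected (x ∷ y ∷ xs) =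
    if does (P? y) then x ∷ beforeSelected (y ∷ xs) else beforeSelected (y ∷ xs)

  -- Each kept entry except the last is matched with its selected successor, which lies in `xs`; the
  -- last entry accounts for the extra 1.
  length-beforeSelected : ∀ x xs →
    length (beforeSelected (x ∷ xs)) ≡ ℕ.suc (length (filter P? xs))
  length-beforeSelected x []       = refl
  length-beforeSelected x (y ∷ xs) with P? y
  ... | yes _ = cong ℕ.suc (length-beforeSelected y xs)
  ... | no  _ = length-beforeSelected y xs

  beforeSelected-⊆ : ∀ xs → beforeSelected xs ⊆ xs
  beforeSelected-⊆ []           = []
  beforeSelected-⊆ (x ∷ [])     = refl ∷ []
  beforeSelected-⊆ (x ∷ y ∷ xs) with beforeSelected-⊆ (y ∷ xs) | P? y
  ... | ys⊆ | yes _ = refl ∷ ys⊆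
  ... | ys⊆ | no  _ = x ∷ʳ ys⊆

  beforeSelected-! : Unique xs → Unique (beforeSelected xs)
  beforeSelected-! {xs = []}         _ = []
  beforeSelected-! {xs = _ ∷ []}     _ = [] ∷ []
  beforeSelected-! {xs = x ∷ y ∷ xs} (x∉ ∷ xs!) with P? y
  ... | yes _ = All.tabulate (All.lookup x∉ ∘ Sublist.lookup (beforeSelected-⊆ (y ∷ xs)))
                ∷ beforeSelected-! xs!
  ... | no  _ = beforeSelected-! xs!

  ∈-beforeSelected⁺ : x ∈ xs → (∀ y → Infix _≡_ (x ∷ y ∷ []) xs → P y) → x ∈ beforeSelected xs
  ∈-beforeSelected⁺ {xs = _ ∷ []}     x∈ next = x∈
  ∈-beforeSelected⁺ {xs = _ ∷ y ∷ xs} x∈ next with P? y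
  ∈-beforeSelected⁺ (here refl) next | yes _ = here refl
  ∈-beforeSelected⁺ (here refl) next | no ¬p =
    contradiction (next _ (here (refl ∷ refl ∷ []))) ¬p
  ∈-beforeSelected⁺ (there x∈)  next | yes _ = there (∈-beforeSelected⁺ x∈ λ y → next y ∘ there)
  ∈-beforeSelected⁺ (there x∈)  next | no  _ = ∈-beforeSelected⁺ x∈ λ y → next y ∘ there

  -- Distinctness ensures that the occurrence of `x` that was kept is the one followed by `y`; with
  -- repetitions another occurrence could have an unselected successor.
  ∈-beforeSelected⁻ : Unique xs → x ∈ beforeSelected xs →
                      ∀ y → Infix _≡_ (x ∷ y ∷ []) xs → P y
  ∈-beforeSelected⁻ {xs = _ ∷ []} xs! x∈ y (here (_ ∷ ()))
  ∈-beforeSelected⁻ {xs = _ ∷ []} xs! x∈ y (there (here ()))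
  ∈-beforeSelected⁻ {xs = u ∷ v ∷ xs} xs! x∈ y i with P? v
  ∈-beforeSelected⁻ _         _           y (here (refl ∷ refl ∷ _)) | yes p = p
  ∈-beforeSelected⁻ (u∉ ∷ _)  (here refl) y (there i) | yes _ =
    contradiction refl (All.lookup u∉ (infix⇒∈ i))
  ∈-beforeSelected⁻ (_ ∷ xs!) (there x∈)  y (there i) | yes _ = ∈-beforeSelected⁻ xs! x∈ y i
  ∈-beforeSelected⁻ {xs = _ ∷ v ∷ xs} (u∉ ∷ _) x∈ y (here (refl ∷ _)) | no _ =
    contradiction refl (All.lookup u∉ (Sublist.lookup (beforeSelected-⊆ (v ∷ xs)) x∈))
  ∈-beforeSelected⁻ (_ ∷ xs!) x∈          y (there i) | no _ = ∈-beforeSelected⁻ xs! x∈ y i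

-- Monomials

module _ {n : ℕ} where

  lookup-ext : ∀ {p q : Monomial n} → (∀ k → lookup p k ≡ lookup q k) → p ≡ q
  lookup-ext {p} {q} eq =
    trans (sym (Vec.tabulate∘lookup p)) (trans (Vec.tabulate-cong eq) (Vec.tabulate∘lookup q))

  lookup-𝟙 : ∀ k → lookup (𝟙 {n}) k ≡ 0
  lookup-𝟙 k = Vec.lookup-replicate k 0

  lookup-· : ∀ (p q : Monomial n) k → lookup (p · q) k ≡ lookup p k + lookup q k
  lookup-· p q k = Vec.lookup-zipWith _+_ k p q

  lookup-𝕩 : ∀ (i : Fin n) j → lookup (𝕩 i ^ j) i ≡ j
  lookup-𝕩 i j = Vec.lookup∘update i 𝟙 j

  lookup-𝕩-≢ : ∀ {i k : Fin n} j → k ≢ i → lookup (𝕩 i ^ j) k ≡ 0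
  lookup-𝕩-≢ {k = k} j k≢i = trans (Vec.lookup∘update′ k≢i 𝟙 j) (lookup-𝟙 k)

  lookup-·-𝕩 : ∀ (p : Monomial n) i j → lookup (p · 𝕩 i ^ j) i ≡ lookup p i + j
  lookup-·-𝕩 p i j = trans (lookup-· p _ i) (cong (lookup p i +_) (lookup-𝕩 i j))

  lookup-·-𝕩-≢ : ∀ (p : Monomial n) {i k} j → k ≢ i → lookup (p · 𝕩 i ^ j) k ≡ lookup p k
  lookup-·-𝕩-≢ p {k = k} j k≢i =
    trans (lookup-· p _ k) (trans (cong (lookup p k +_) (lookup-𝕩-≢ j k≢i)) (ℕ.+-identityʳ _))

  ·-identityʳ : ∀ (p : Monomial n) → p · 𝟙 ≡ p
  ·-identityʳ p = lookup-ext λ k →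
    trans (lookup-· p 𝟙 k) (trans (cong (lookup p k +_) (lookup-𝟙 k)) (ℕ.+-identityʳ _))

degree-𝟙 : ∀ n → degree (𝟙 {n}) ≡ 0
degree-𝟙 ℕ.zero    = refl
degree-𝟙 (ℕ.suc n) = degree-𝟙 n

degree-·-𝕩 : ∀ {n} (p : Monomial n) i j → degree (p · 𝕩 i ^ j) ≡ j + degree p
degree-·-𝕩 (a Vec.∷ p) zero    j = begin
  (a + j) + degree (p · 𝟙)  ≡⟨ cong₂ _+_ (ℕ.+-comm a j) (cong degree (·-identityʳ p)) ⟩
  (j + a) + degree p        ≡⟨ ℕ.+-assoc j a _ ⟩
  j + (a + degree p)        ∎
  where open ≡-Reasoning
degree-·-𝕩 (a Vec.∷ p) (suc i) j = begin
  (a + 0) + degree (p · 𝕩 i ^ j)  ≡⟨ cong₂ _+_ (ℕ.+-identityʳ a) (degree-·-𝕩 p i j) ⟩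
  a + (j + degree p)              ≡⟨ ℕ.+-assoc a j _ ⟨
  (a + j) + degree p              ≡⟨ cong (_+ degree p) (ℕ.+-comm a j) ⟩
  (j + a) + degree p              ≡⟨ ℕ.+-assoc j a _ ⟩
  j + (a + degree p)              ∎
  where open ≡-Reasoning

-- Fibre sizes and products of powers as exponent vectors

module _ {n : ℕ} (f : A → Fin n) where

  fibre : List A → Fin n → List A
  fibre xs k = filter (λ x → f x F.≟ k) xs

  -- For `f = proj₂` on the dimension pairs of `T` the fibre over `k` is `D T k`, so the degree of
  -- this monomial is the sum of all the cardinalities of the sets `D T k`.
  fibreSizes : List A → Monomial n
  fibreSizes xs = Vec.tabulate (length ∘ fibre xs)

  lookup-fibreSizes : ∀ xs k → lookup (fibreSizes xs) k ≡ length (fibre xs k)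
  lookup-fibreSizes xs = Vec.lookup∘tabulate (length ∘ fibre xs)

  fibreSizes-[] : fibreSizes [] ≡ 𝟙
  fibreSizes-[] = lookup-ext λ k → trans (lookup-fibreSizes [] k) (sym (lookup-𝟙 k))

  fibreSizes-∷ : ∀ x xs → fibreSizes (x ∷ xs) ≡ fibreSizes xs · 𝕩 f x ^ 1
  fibreSizes-∷ x xs = lookup-ext λ k → trans (lookup-fibreSizes (x ∷ xs) k) (step k)
    where
    open ≡-Reasoning
    step : ∀ k → length (fibre (x ∷ xs) k) ≡ lookup (fibreSizes xs · 𝕩 f x ^ 1) k
    step k with f x F.≟ k
    ... | yes refl = begin
      1 + length (fibre xs (f x))                  ≡⟨ ℕ.+-comm 1 _ ⟩
      length (fibre xs (f x)) + 1                  ≡⟨ cong (_+ 1) (lookup-fibreSizes xs (f x)) ⟨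
      lookup (fibreSizes xs) (f x) + 1             ≡⟨ lookup-·-𝕩 (fibreSizes xs) (f x) 1 ⟨
      lookup (fibreSizes xs · 𝕩 f x ^ 1) (f x)     ∎
    ... | no fx≢k = begin
      length (fibre xs k)                          ≡⟨ lookup-fibreSizes xs k ⟨
      lookup (fibreSizes xs) k                     ≡⟨ lookup-·-𝕩-≢ (fibreSizes xs) 1 (fx≢k ∘ sym) ⟨
      lookup (fibreSizes xs · 𝕩 f x ^ 1) k         ∎

  degree-fibreSizes : ∀ xs → degree (fibreSizes xs) ≡ length xs
  degree-fibreSizes []       = trans (cong degree fibreSizes-[]) (degree-𝟙 n)
  degree-fibreSizes (x ∷ xs) = begin
    degree (fibreSizes (x ∷ xs))           ≡⟨ cong degree (fibreSizes-∷ x xs) ⟩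
    degree (fibreSizes xs · 𝕩 f x ^ 1)     ≡⟨ degree-·-𝕩 (fibreSizes xs) (f x) 1 ⟩
    ℕ.suc (degree (fibreSizes xs))         ≡⟨ cong ℕ.suc (degree-fibreSizes xs) ⟩
    length (x ∷ xs)                        ∎
    where open ≡-Reasoning

module _ {n : ℕ} (f : Fin n → ℕ) where

  -- The shape of `Φ` with an arbitrary list of variables, which allows induction on that list.
  ∏ : List (Fin n) → Monomial n
  ∏ ks = foldr _·_ 𝟙 (map (λ k → 𝕩 k ^ f k) ks)

  lookup-∏-∉ : ∀ ks {i} → i ∉ ks → lookup (∏ ks) i ≡ 0
  lookup-∏-∉ []       {i} i∉ = lookup-𝟙 i
  lookup-∏-∉ (k ∷ ks) {i} i∉ = trans (lookup-· (𝕩 k ^ f k) (∏ ks) i)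
    (cong₂ _+_ (lookup-𝕩-≢ (f k) (i∉ ∘ here)) (lookup-∏-∉ ks (i∉ ∘ there)))

  lookup-∏-∈ : ∀ {ks i} → Unique ks → i ∈ ks → lookup (∏ ks) i ≡ f i
  lookup-∏-∈ {k ∷ ks} {i} (k∉ ∷ ks!) (here refl) = trans (lookup-· (𝕩 k ^ f k) (∏ ks) i)
    (trans (cong₂ _+_ (lookup-𝕩 k (f k)) (lookup-∏-∉ ks λ k∈ → All.lookup k∉ k∈ refl))
           (ℕ.+-identityʳ _))
  lookup-∏-∈ {k ∷ ks} {i} (k∉ ∷ ks!) (there i∈) = trans (lookup-· (𝕩 k ^ f k) (∏ ks) i)
    (cong₂ _+_ (lookup-𝕩-≢ (f k) λ i≡k → All.lookup k∉ i∈ (sym i≡k)) (lookup-∏-∈ ks! i∈))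

module _ {n : ℕ} (H : HessenbergFunction n) where
  open HessenbergFunction H

  -- Inserting a new largest letter

  private variable
    a b c i : Fin n
    ws : Word n

  -- After the insertion `v` is followed either by the old head of `w`, which is allowed by
  -- hypothesis, or by `i`, which is allowed since `v < i ≤ h i`.
  permissible-∷-insertAt : ∀ w → v F.< i → Permissible H (v ∷ w) → ∀ k →
    Permissible H (insertAt w k i) ⇔ Permissible H (v ∷ insertAt w k i)
  permissible-∷-insertAt {v = v} {i = i} w v<i perm k = mk⇔ (extend w perm k) Linked.tail
    where
    extend : ∀ w → Permissible H (v ∷ w) → ∀ k →
             Permissible H (insertAt w k i) → Permissible H (v ∷ insertAt w k i)
    extend []      _       zero    q = ℕ.≤-trans (ℕ.<⇒≤ v<i) (extensive i) ∷ q
    extend (_ ∷ _) _       zero    q = ℕ.≤-trans (ℕ.<⇒≤ v<i) (extensive i) ∷ q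
    extend (_ ∷ _) (p ∷ _) (suc k) q = p ∷ q

  -- Prepending `v` leaves the status of the old gaps unchanged. The only new gap is in front of
  -- `v`, where the one new requirement is `i F.≤ h v`.
  bullets-∷ : v F.< i → Permissible H (v ∷ ws) →
    bullets H i (v ∷ ws) ≡ map suc (bullets H i ws) ++ filter (λ _ → i F.≤? h v) [ zero ]
  bullets-∷ {v = v} {i = i} {ws = ws} v<i perm = begin
    filter P? (reverse (allFin (ℕ.suc m)))
      ≡⟨ cong (filter P?) (reverse-allFin m) ⟩
    filter P? (map suc (reverse (allFin m)) ++ [ zero ])
      ≡⟨ L.filter-++ P? (map suc (reverse (allFin m))) [ zero ] ⟩
    filter P? (map suc (reverse (allFin m))) ++ filter P? [ zero ]
      ≡⟨ cong₂ _++_ left right ⟩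
    map suc (bullets H i ws) ++ filter (λ _ → i F.≤? h v) [ zero ] ∎
    where
    open ≡-Reasoning
    m : ℕ
    m = ℕ.suc (length ws)
    P? : Decidable (λ k → Permissible H (insertAt (v ∷ ws) k i))
    P? k = permissible? H (insertAt (v ∷ ws) k i)
    left : filter P? (map suc (reverse (allFin m))) ≡ map suc (bullets H i ws)
    left = trans (filter-map P? suc (reverse (allFin m)))
      (cong (map suc) (sym (L.filter-≐ (λ k → permissible? H (insertAt ws k i)) (P? ∘ suc)
        ( (λ {k} → to (permissible-∷-insertAt ws v<i perm k))
        , (λ {k} → from (permissible-∷-insertAt ws v<i perm k)))
        (reverse (allFin m)))))
    right : filter P? [ zero ] ≡ filter (λ _ → i F.≤? h v) [ zero ]
    right = filter-[x] P? (λ _ → i F.≤? h v) (mk⇔ Linked.head (_∷ perm))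

  bullets-[] : ∀ i → bullets H i [] ≡ [ zero ]
  bullets-[] i = L.filter-accept (λ k → permissible? H (insertAt [] k i)) {xs = []} [-]

  length-bullets : All (F._< i) ws → Permissible H ws →
    length (bullets H i ws) ≡ ℕ.suc (length (filter (λ v → i F.≤? h v) ws))
  length-bullets {i = i} []          perm = cong length (bullets-[] i)
  length-bullets {i = i} {ws = v ∷ ws} (v<i ∷ ws<i) perm = begin
    length (bullets H i (v ∷ ws))
      ≡⟨ cong length (bullets-∷ v<i perm) ⟩
    length (map suc (bullets H i ws) ++ E)
      ≡⟨ L.length-++ (map suc (bullets H i ws)) ⟩
    length (map suc (bullets H i ws)) + length E
      ≡⟨ cong (_+ length E) (L.length-map suc (bullets H i ws)) ⟩
    length (bullets H i ws) + length E
      ≡⟨ cong (_+ length E) (length-bullets ws<i (Linked.tail perm)) ⟩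
    ℕ.suc (length (filter (λ v → i F.≤? h v) ws)) + length E
      ≡⟨ last ⟩
    ℕ.suc (length (filter (λ v → i F.≤? h v) (v ∷ ws))) ∎
    where
    open ≡-Reasoning
    E : List (Fin (2 + length ws))
    E = filter (λ _ → i F.≤? h v) [ zero ]
    last : ℕ.suc (length (filter (λ v → i F.≤? h v) ws)) + length E ≡
           ℕ.suc (length (filter (λ v → i F.≤? h v) (v ∷ ws)))
    last = cong ℕ.suc (length-filter-∷ (λ v → i F.≤? h v) v ws)

  -- If ws is the part of a word to the right of b and all its letters are below b,
  -- these are the a for which (a , b) is a dimension pair.
  lowerEnds : Fin n → Word n → Word n
  lowerEnds b = beforeSelected (λ c → b F.≤? h c)

  -- Turns a numerical gap into an explicit splitting of the word; `j` will be the number of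
  -- dimension pairs that the insertion creates.
  InsertedAt : Fin n → (w : Word n) → Fin (ℕ.suc (length w)) → ℕ → Set
  InsertedAt i w k j = ∃₂ λ xs ys →
    w ≡ xs ++ ys × insertAt w k i ≡ xs ++ i ∷ ys × length (lowerEnds i ys) ≡ j

  -- Exactly J bullets lie to the right of the J-th one, and each of them directly
  -- follows a letter of lowerEnds i ys.
  bullet-insertedAt : All (F._< i) ws → Permissible H ws →
                      Indexed (InsertedAt i ws) (bullets H i ws)
  bullet-insertedAt {i = i} [] perm =
    subst (Indexed (InsertedAt i [])) (sym (bullets-[] i))
      λ { zero → [] , [] , refl , refl , refl }
  bullet-insertedAt {i = i} {ws = v ∷ ws} (v<i ∷ ws<i) perm =
    subst (Indexed (InsertedAt i (v ∷ ws))) (sym (bullets-∷ v<i perm))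
      (Indexed-++ {P = InsertedAt i (v ∷ ws)} (map suc (bullets H i ws))
        (Indexed-map {P = InsertedAt i (v ∷ ws)} suc (bullets H i ws) λ J →
          let xs , ys , eq₁ , eq₂ , len = bullet-insertedAt ws<i (Linked.tail perm) J
          in v ∷ xs , ys , cong (v ∷_) eq₁ , cong (v ∷_) eq₂ , len)
        leftmost)
    where
    P : Fin (2 + length ws) → ℕ → Set
    P k j = InsertedAt i (v ∷ ws) k (length (map suc (bullets H i ws)) + j)
    leftmost : Indexed P (filter (λ _ → i F.≤? h v) [ zero ])
    -- In front of `v` the right-hand part is the whole word. Its number of lower ends and the
    -- number of earlier bullets agree, both being one more than the number of letters `c` of `ws`
    -- with `i F.≤ h c`.
    leftmost = Indexed-filter-[x] {P = P} (λ _ → i F.≤? h v) ([] , v ∷ ws , refl , refl , (begin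
      length (lowerEnds i (v ∷ ws))                   ≡⟨ length-beforeSelected _ v ws ⟩
      ℕ.suc (length (filter (λ c → i F.≤? h c) ws))   ≡⟨ length-bullets ws<i (Linked.tail perm) ⟨
      length (bullets H i ws)                         ≡⟨ L.length-map suc (bullets H i ws) ⟨
      length (map suc (bullets H i ws))               ≡⟨ ℕ.+-identityʳ _ ⟨
      length (map suc (bullets H i ws)) + 0           ∎))
      where open ≡-Reasoning

  -- Dimension pairs

  ∈-D : ∀ {T k p} → p ∈ D H T k ⇔ (proj₂ p ≡ k × IsDimensionPair H T (proj₁ p) k)
  ∈-D {T} {k} {a , b} = mk⇔
    (λ p∈ → let p∈ds , b≡k = ∈-filter⁻ (λ p → proj₂ p F.≟ k) p∈
                _ , dp = ∈-filter⁻ (uncurry (isDimensionPair? H T)) {xs = cartesianProduct (allFin n) (allFin n)} p∈ds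
            in b≡k , subst (IsDimensionPair H T a) b≡k dp)
    λ { (refl , dp) → ∈-filter⁺ (λ p → proj₂ p F.≟ k)
          (∈-filter⁺ (uncurry (isDimensionPair? H T))
            (∈-cartesianProduct⁺ (∈-allFin a) (∈-allFin b)) dp)
          refl }

  D-! : ∀ T k → Unique (D H T k)
  D-! T k = Unique.filter⁺ (λ p → proj₂ p F.≟ k)
    (Unique.filter⁺ (uncurry (isDimensionPair? H T))
      (Unique.cartesianProduct⁺ (Unique.allFin⁺ n) (Unique.allFin⁺ n)))

  -- Index 0 stands for the number 1, and no smaller number is available as a partner.
  D-zero : ∀ T {k} → toℕ k ≡ 0 → length (D H T k) ≡ 0
  D-zero T {k} k≡0 with D H T k in eq
  ... | []    = refl
  ... | p ∷ _ with from-D ← to (∈-D {T} {k} {p}) (subst (p ∈_) (sym eq) (here refl)) =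
    contradiction (subst (toℕ (proj₁ p) ℕ.<_) k≡0 (proj₁ (proj₂ from-D))) λ ()

  NextBound : Word n → Fin n → Fin n → Set
  NextBound T a b = ∀ c → Infix _≡_ (a ∷ c ∷ []) T → b F.≤ h c

  dimensionPair-insert : ∀ xs {ys} → Permissible H (xs ++ i ∷ ys) → b F.< i →
    IsDimensionPair H (xs ++ ys) a b ⇔ IsDimensionPair H (xs ++ i ∷ ys) a b
  dimensionPair-insert {i = i} {b = b} {a = a} xs {ys} perm b<i = mk⇔
    (λ (a<b , ba⊆ , next) → a<b , ⊆-insert xs ba⊆ , λ c p → next⁺ a<b next c p)
    (λ (a<b , ba⊆ , next) → a<b , ⊆-delete xs (i∉ a<b) ba⊆ , λ c p → next⁻ next c p)
    where
    i≢b : i ≢ b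
    i≢b = F.<⇒≢ b<i ∘ sym
    i≢a : a F.< b → i ≢ a
    i≢a a<b = F.<⇒≢ (F.<-trans a<b b<i) ∘ sym
    i∉ : a F.< b → i ∉ b ∷ a ∷ []
    i∉ a<b (here i≡b)         = i≢b i≡b
    i∉ a<b (there (here i≡a)) = i≢a a<b i≡a
    next⁺ : a F.< b → NextBound (xs ++ ys) a b → NextBound (xs ++ i ∷ ys) a b
    next⁺ a<b next c p with c F.≟ i
    -- Here `i` is the new successor of `a`, and `b < i ≤ h i`.
    ... | yes refl = ℕ.≤-trans (ℕ.<⇒≤ b<i) (extensive i)
    ... | no  c≢i  = next c (infix-delete xs (i≢a a<b ∘ sym) c≢i p)
    next⁻ : NextBound (xs ++ i ∷ ys) a b → NextBound (xs ++ ys) a b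
    next⁻ next c p with infix-insert xs p
    ... | inj₁ q = next c q
    -- Here `i` was placed between `a` and `c`, so permissibility at `i` and `c` gives
    -- `b < i ≤ h c`.
    ... | inj₂ q = ℕ.≤-trans (ℕ.<⇒≤ b<i) (linked-infix perm q)

  length-D-insert : ∀ xs {ys k} → Permissible H (xs ++ i ∷ ys) → k F.< i →
    length (D H (xs ++ i ∷ ys) k) ≡ length (D H (xs ++ ys) k)
  length-D-insert xs perm k<i = ↭-length (unique∧set⇒↭ (D-! _ _) (D-! _ _) λ {p} → mk⇔
    (λ p∈ → let b≡k , dp = to ∈-D p∈ in
      from ∈-D (b≡k , from (dimensionPair-insert xs perm k<i) dp))
    (λ p∈ → let b≡k , dp = to ∈-D p∈ in
      from ∈-D (b≡k , to (dimensionPair-insert xs perm k<i) dp)))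

  -- Neither `i` nor any `a` in `ys` occurs in `xs`, the first because all letters of `xs` are
  -- smaller than `i`, the second by distinctness. Hence both the order condition and the successor
  -- condition for `(a , i)` can be read off in `ys`.
  length-D-inserted : ∀ xs {ys} → Unique (xs ++ i ∷ ys) → All (F._< i) (xs ++ ys) →
    length (D H (xs ++ i ∷ ys) i) ≡ length (lowerEnds i ys)
  length-D-inserted {i = i} xs {ys} T! <i = trans
    (↭-length (unique∧set⇒↭ (D-! _ _)
      (Unique.map⁺ (cong proj₁) (beforeSelected-! _ ys!)) λ {p} → mk⇔ (sound p) (complete p)))
    (L.length-map (_, i) (lowerEnds i ys))
    where
    ys! : Unique ys
    ys! = Unique-++⁻ʳ [ i ] (Unique-++⁻ʳ xs T!)
    i∉xs : i ∉ xs
    i∉xs i∈ = F.<-irrefl refl (All.lookup <i (∈-++⁺ˡ i∈))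
    sound : ∀ p → p ∈ D H (xs ++ i ∷ ys) i → p ∈ map (_, i) (lowerEnds i ys)
    sound (a , b) p∈ with to ∈-D p∈
    ... | refl , a<i , ia⊆ , next =
      ∈-map⁺ (_, i) (∈-beforeSelected⁺ _ (a∈ (⊆-++⁻ʳ xs i∉xs ia⊆)) λ c p → next c (xs ++ⁱ there p))
      where
      a∈ : i ∷ a ∷ [] ⊆ i ∷ ys → a ∈ ys
      a∈ (_ ∷ʳ q)   = Sublist.lookup q (there (here refl))
      a∈ (refl ∷ q) = Sublist.lookup q (here refl)
    complete : ∀ p → p ∈ map (_, i) (lowerEnds i ys) → p ∈ D H (xs ++ i ∷ ys) i
    complete p p∈ with ∈-map⁻ (_, i) p∈
    ... | a , a∈ , refl = from ∈-D
      ( refl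
      , All.lookup <i (∈-++⁺ʳ xs a∈ys)
      , Sublist.++⁺ˡ xs (refl ∷ from∈ a∈ys)
      , λ c p → ∈-beforeSelected⁻ _ ys! a∈ c (strip (infix-++⁻ʳ xs a∉xs p)) )
      where
      a∈ys : a ∈ ys
      a∈ys = Sublist.lookup (beforeSelected-⊆ _ ys) a∈
      a∉xs : a ∉ xs
      a∉xs = Unique-++⁻-disjoint xs T! (there a∈ys)
      strip : ∀ {c} → Infix _≡_ (a ∷ c ∷ []) (i ∷ ys) → Infix _≡_ (a ∷ c ∷ []) ys
      strip (here (refl ∷ _)) = ⊥-elim (F.<-irrefl refl (All.lookup <i (∈-++⁺ʳ xs a∈ys)))
      strip (there p) = p

  -- The tree

  private variable
    l : ℕ

  -- The gap that `word` uses at a `child`, named so that lemmas about `insertAt` can refer to it.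
  insertLetter : .(l<n : l ℕ.< n) (v : Vertex H l) (j : Fin (β H (fromℕ< l<n))) →
    .(toℕ j ℕ.< length (bullets H (fromℕ< l<n) (word H v))) →
    Fin (ℕ.suc (length (word H v)))
  insertLetter l<n v j j<len = L.lookup (bullets H (fromℕ< l<n) (word H v)) (fromℕ< j<len)

  length-word : ∀ (v : Vertex H l) → length (word H v) ≡ l
  length-word (root _)              = refl
  length-word (child l<n v j j<len) = trans
    (L.length-insertAt (word H v) (insertLetter l<n v j j<len) (fromℕ< l<n))
    (cong ℕ.suc (length-word v))

  ∈-word : ∀ (v : Vertex H l) {k} → k ∈ word H v ⇔ toℕ k ℕ.< l
  ∈-word (root 0<n) {k} = mk⇔
    (λ { (here refl) → s≤s (ℕ.≤-reflexive (F.toℕ-fromℕ< 0<n)) })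
    (λ k<1 → here (F.toℕ-injective (trans (ℕ.n<1⇒n≡0 k<1) (sym (F.toℕ-fromℕ< 0<n)))))
  ∈-word {l = ℕ.suc l} (child l<n v j j<len) {k} = mk⇔
    (λ k∈ → case ∈-resp-↭ w↭ k∈ of λ where
      (here refl) → s≤s (ℕ.≤-reflexive (F.toℕ-fromℕ< l<n))
      (there k∈w) → ℕ.m<n⇒m<1+n (to (∈-word v) k∈w))
    (λ k<1+l → ∈-resp-↭ (↭-sym w↭) (case ℕ.m<1+n⇒m<n∨m≡n k<1+l of λ where
      (inj₁ k<l) → there (from (∈-word v) k<l)
      (inj₂ k≡l) → here (F.toℕ-injective (trans k≡l (sym (F.toℕ-fromℕ< l<n))))))
    where
    w↭ : word H (child l<n v j j<len) ↭ fromℕ< l<n ∷ word H v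
    w↭ = insertAt-↭ (word H v) (insertLetter l<n v j j<len) (fromℕ< l<n)

  word-< : ∀ .(l<n : l ℕ.< n) (v : Vertex H l) → All (F._< fromℕ< l<n) (word H v)
  word-< l<n v = All.tabulate λ {k} k∈ →
    subst (toℕ k ℕ.<_) (sym (F.toℕ-fromℕ< l<n)) (to (∈-word v) k∈)

  word-! : ∀ (v : Vertex H l) → Unique (word H v)
  word-! (root _)              = [] ∷ []
  word-! (child l<n v j j<len) = Unique-resp-↭
    (↭-sym (insertAt-↭ (word H v) (insertLetter l<n v j j<len) (fromℕ< l<n)))
    (All.map (λ k<i i≡k → F.<⇒≢ k<i (sym i≡k)) (word-< l<n v) ∷ word-! v)

  word-permissible : ∀ (v : Vertex H l) → Permissible H (word H v)
  word-permissible (root _)              = [-]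
  word-permissible (child l<n v j j<len) =
    proj₂ (∈-filter⁻ (λ k → permissible? H (insertAt (word H v) k (fromℕ< l<n)))
      {xs = reverse (allFin (ℕ.suc (length (word H v))))}
      (∈-lookup {xs = bullets H (fromℕ< l<n) (word H v)} (fromℕ< j<len)))

  word-isFilling : ∀ (v : Vertex H n) → IsFilling H (word H v)
  word-isFilling v = word-permissible v ,
    unique∧set⇒↭ (word-! v) (Unique.allFin⁺ n) (λ {k} →
      mk⇔ (λ _ → ∈-allFin k) (λ _ → from (∈-word v) (F.toℕ<n k)))

  -- Guarantees an edge for every exponent allowed by `𝓑`. The `i - 1` letters of the word split
  -- into those with `h k < i` and those with `i ≤ h k`; the latter, plus the right end, give the
  -- bullets, which leaves `i` minus the number of the former.
  length-bullets-word : ∀ .(l<n : l ℕ.< n) (v : Vertex H l) →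
    length (bullets H (fromℕ< l<n) (word H v)) ≡ β H (fromℕ< l<n)
  length-bullets-word {l} l<n v = begin
    length (bullets H i′ w)                      ≡⟨ length-bullets (word-< l<n v) (word-permissible v) ⟩
    ℕ.suc (length (filter ≥i? w))               ≡⟨ ℕ.m+n∸m≡n (length (filter <i? w)) _ ⟨
    length (filter <i? w) + ℕ.suc (length (filter ≥i? w)) ∸ length (filter <i? w)
      ≡⟨ cong₂ _∸_ (trans (ℕ.+-suc _ _) (cong ℕ.suc split)) (↭-length same) ⟩
    val i′ ∸ length (filter <i? (allFin n))      ∎
    where
    open ≡-Reasoning
    i′ : Fin n
    i′ = fromℕ< l<n
    w : Word n
    w = word H v
    <i? : Decidable (λ k → h k F.< i′)
    <i? k = h k F.<? i′
    ≥i? : Decidable (λ k → i′ F.≤ h k)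
    ≥i? k = i′ F.≤? h k
    split : length (filter <i? w) + length (filter ≥i? w) ≡ toℕ i′
    split = trans (length-filter-⊎ <i? ≥i? (λ _ → ℕ.<⇒≱) (λ k → ℕ.<-≤-connex (toℕ (h k)) (toℕ i′)) w)
      (trans (length-word v) (sym (F.toℕ-fromℕ< l<n)))
    -- Counting over the word or over all of `Fin n` is the same, because `k ≤ h k < i` forces `k`
    -- to be a letter of the word already.
    same : filter <i? w ↭ filter <i? (allFin n)
    same = unique∧set⇒↭ (Unique.filter⁺ <i? (word-! v)) (Unique.filter⁺ <i? (Unique.allFin⁺ n)) λ {k} → mk⇔
      (λ k∈ → ∈-filter⁺ <i? (∈-allFin k) (proj₂ (∈-filter⁻ <i? {xs = w} k∈)))
      (λ k∈ → let hk<i = proj₂ (∈-filter⁻ <i? {xs = allFin n} k∈) in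
        ∈-filter⁺ <i? (from (∈-word v)
          (subst (toℕ k ℕ.<_) (F.toℕ-fromℕ< l<n) (ℕ.≤-<-trans (extensive k) hk<i))) hk<i)

  -- A path to Level `l` uses only variables with number at most `l`, while `l ≤ toℕ k` says that
  -- the number of `k` is at least `l + 1`.
  pathProduct-≥ : ∀ (v : Vertex H l) k → l ℕ.≤ toℕ k → lookup (pathProduct H v) k ≡ 0
  pathProduct-≥ (root _)              k _   = lookup-𝟙 k
  pathProduct-≥ (child l<n v j j<len) k l<k = trans
    (lookup-·-𝕩-≢ (pathProduct H v) (toℕ j) (λ { refl → ℕ.<-irrefl (sym (F.toℕ-fromℕ< l<n)) l<k }))
    (pathProduct-≥ v k (ℕ.<⇒≤ l<k))

  module _ .(l<n : l ℕ.< n) (v : Vertex H l) (j : Fin (β H (fromℕ< l<n)))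
           .(j<len : toℕ j ℕ.< length (bullets H (fromℕ< l<n) (word H v))) where

    pathProduct-child : lookup (pathProduct H (child l<n v j j<len)) (fromℕ< l<n) ≡ toℕ j
    pathProduct-child = trans (lookup-·-𝕩 (pathProduct H v) (fromℕ< l<n) (toℕ j))
      (cong (_+ toℕ j) (pathProduct-≥ v (fromℕ< l<n) (ℕ.≤-reflexive (sym (F.toℕ-fromℕ< l<n)))))

    pathProduct-child-< : ∀ {k} → toℕ k ℕ.< l →
      lookup (pathProduct H (child l<n v j j<len)) k ≡ lookup (pathProduct H v) k
    pathProduct-child-< k<l = lookup-·-𝕩-≢ (pathProduct H v) (toℕ j)
      λ { refl → ℕ.<-irrefl (F.toℕ-fromℕ< l<n) k<l }

  -- Induction along the root path: earlier letters keep their counts by `length-D-insert`, and the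
  -- newest letter receives exactly `j` pairs by `bullet-insertedAt` and `length-D-inserted`.
  length-D-word : ∀ (v : Vertex H l) k → toℕ k ℕ.< l →
    length (D H (word H v) k) ≡ lookup (pathProduct H v) k
  length-D-word (root 0<n) k k<1 =
    trans (D-zero _ (ℕ.n<1⇒n≡0 k<1)) (sym (lookup-𝟙 k))
  length-D-word (child l<n v j j<len) k k<1+l
    with xs , ys , w≡ , T≡ , ends ←
           bullet-insertedAt (word-< l<n v) (word-permissible v) (fromℕ< j<len)
    with ℕ.m<1+n⇒m<n∨m≡n k<1+l
  ... | inj₁ k<l = begin
    length (D H T k)                       ≡⟨ cong (λ T → length (D H T k)) T≡ ⟩
    length (D H (xs ++ i′ ∷ ys) k)          ≡⟨ length-D-insert xs
                                                (subst (Permissible H) T≡ (word-permissible v′))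
                                                (subst (toℕ k ℕ.<_) (sym (F.toℕ-fromℕ< l<n)) k<l) ⟩
    length (D H (xs ++ ys) k)              ≡⟨ cong (λ w → length (D H w k)) w≡ ⟨
    length (D H (word H v) k)              ≡⟨ length-D-word v k k<l ⟩
    lookup (pathProduct H v) k             ≡⟨ pathProduct-child-< l<n v j j<len k<l ⟨
    lookup (pathProduct H v′) k             ∎
    where
    open ≡-Reasoning
    i′ = fromℕ< l<n
    v′ = child l<n v j j<len
    T = word H v′
  ... | inj₂ k≡l with refl ← F.toℕ-injective (trans k≡l (sym (F.toℕ-fromℕ< l<n))) = begin
    length (D H T i′)                       ≡⟨ cong (λ T → length (D H T i′)) T≡ ⟩
    length (D H (xs ++ i′ ∷ ys) i′)          ≡⟨ length-D-inserted xs
                                                (subst Unique T≡ (word-! v′))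
                                                (subst (All (F._< i′)) w≡ (word-< l<n v)) ⟩
    length (lowerEnds i′ ys)                ≡⟨ ends ⟩
    toℕ (fromℕ< j<len)                     ≡⟨ F.toℕ-fromℕ< j<len ⟩
    toℕ j                                  ≡⟨ pathProduct-child l<n v j j<len ⟨
    lookup (pathProduct H v′) i′             ∎
    where
    open ≡-Reasoning
    i′ = fromℕ< l<n
    v′ = child l<n v j j<len
    T = word H v′

  -- Correspondence between exponent vectors and leaves

  child-cong : ∀ .{l<n : l ℕ.< n} {u v : Vertex H l} {j k : Fin (β H (fromℕ< l<n))}
    .{j<len : toℕ j ℕ.< length (bullets H (fromℕ< l<n) (word H u))}
    .{k<len : toℕ k ℕ.< length (bullets H (fromℕ< l<n) (word H v))} →
    u ≡ v → j ≡ k → child l<n u j j<len ≡ child l<n v k k<len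
  -- The bounds are irrelevant arguments, so parent and exponent determine the vertex.
  child-cong refl refl = refl

  -- The exponent of the newest variable recovers the last edge; the exponents of the earlier
  -- variables are those of the parent, so induction applies.
  pathProduct-injective : ∀ (u v : Vertex H l) →
    (∀ k → toℕ k ℕ.< l → lookup (pathProduct H u) k ≡ lookup (pathProduct H v) k) → u ≡ v
  pathProduct-injective (root _) (root _) eq = refl
  -- A child at Level 1 would need a parent at Level 0, where there are no vertices.
  pathProduct-injective (root _) (child _ () _ _) eq
  pathProduct-injective (child _ () _ _) (root _) eq
  pathProduct-injective (child l<n u j j<len) (child _ v k k<len) eq = child-cong
    (pathProduct-injective u v λ m m<l → trans (sym (pathProduct-child-< l<n u j j<len m<l))
      (trans (eq m (ℕ.m<n⇒m<1+n m<l)) (pathProduct-child-< l<n v k k<len m<l)))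
    (F.toℕ-injective (trans (sym (pathProduct-child l<n u j j<len))
      (trans (eq (fromℕ< l<n) (s≤s (ℕ.≤-reflexive (F.toℕ-fromℕ< l<n))))
        (pathProduct-child l<n v k k<len))))

  -- The number 1 has `β` at most 1. This settles the first variable, which labels no edge and does
  -- not occur in `Φ`.
  𝓑-zero : ∀ α → 𝓑 H α → ∀ {k} → toℕ k ≡ 0 → lookup α k ≡ 0
  𝓑-zero α α∈ {k} k≡0 = ℕ.n<1⇒n≡0 (ℕ.<-≤-trans (α∈ k)
    (ℕ.≤-trans (ℕ.m∸n≤m (val k) (length (filter (λ c → h c F.<? k) (allFin n)))) (s≤s (ℕ.≤-reflexive k≡0))))

  -- Descends from the root, taking at each letter the edge whose exponent is prescribed by `α`.
  -- Agreement is claimed only for letters already placed, since later exponents are still 0 in the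
  -- path product.
  vertexOf : ∀ α → 𝓑 H α → ∀ l → .(l ℕ.< n) →
    ∃ λ (v : Vertex H (ℕ.suc l)) →
      ∀ k → toℕ k ℕ.< ℕ.suc l → lookup (pathProduct H v) k ≡ lookup α k
  vertexOf α α∈ ℕ.zero 0<n = root 0<n , λ k k<1 →
    trans (lookup-𝟙 k) (sym (𝓑-zero α α∈ (ℕ.n<1⇒n≡0 k<1)))
  vertexOf α α∈ (ℕ.suc l) l<n with v , agrees ← vertexOf α α∈ l (ℕ.<-trans (ℕ.n<1+n l) l<n) =
    child l<n v j j<len , λ k k<2+l → case ℕ.m<1+n⇒m<n∨m≡n k<2+l of λ where
      (inj₁ k<1+l) → trans (pathProduct-child-< l<n v j j<len k<1+l) (agrees k k<1+l)
      (inj₂ k≡1+l) → case F.toℕ-injective (trans k≡1+l (sym (F.toℕ-fromℕ< l<n))) of λ where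
        refl → trans (pathProduct-child l<n v j j<len) (F.toℕ-fromℕ< (α∈ i′))
    where
    i′ : Fin n
    i′ = fromℕ< l<n
    j : Fin (β H i′)
    j = fromℕ< (α∈ i′)
    j<len : toℕ j ℕ.< length (bullets H i′ (word H v))
    -- There are exactly `β` bullets, so the bound from `𝓑` says that the required bullet exists.
    j<len = subst (toℕ j ℕ.<_) (sym (length-bullets-word l<n v)) (F.toℕ<n j)

  leafLabel-below : ∀ v → leafLabel H (below v) ≡ pathProduct H v
  leafLabel-below v = ·-identityʳ (pathProduct H v)

  leafLabel-injective : ∀ ℓ ℓ′ → leafLabel H ℓ ≡ leafLabel H ℓ′ → ℓ ≡ ℓ′
  leafLabel-injective (below u) (below v) eq = cong below (pathProduct-injective u v λ k _ →
    cong (λ p → lookup p k)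
      (trans (sym (leafLabel-below u)) (trans eq (leafLabel-below v))))

  -- Recovering the monomial and its degree from the counts

  Φ-≡ : ∀ T α → 𝓑 H α → (∀ k → length (D H T k) ≡ lookup α k) → Φ H T ≡ α
  Φ-≡ T α α∈ D≡ = lookup-ext coefficient
    where
    ≥2? : Decidable (λ (k : Fin n) → 2 ≤ val k)
    ≥2? k = 2 ℕ.≤? val k
    coefficient : ∀ k → lookup (Φ H T) k ≡ lookup α k
    coefficient k with 2 ℕ.≤? val k
    ... | yes 2≤k = trans (lookup-∏-∈ (length ∘ D H T) (Unique.filter⁺ ≥2? (Unique.allFin⁺ n))
                             (∈-filter⁺ ≥2? (∈-allFin k) 2≤k)) (D≡ k)
    -- Only the number 1 remains: `Φ` has no factor for it, and `α` has exponent 0 there by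
    -- `𝓑-zero`.
    ... | no  2≰k = trans (lookup-∏-∉ (length ∘ D H T) (filter ≥2? (allFin n))
                             (λ k∈ → 2≰k (proj₂ (∈-filter⁻ ≥2? {xs = allFin n} k∈))))
                      (sym (𝓑-zero α α∈ (ℕ.n<1⇒n≡0 (ℕ.s<s⁻¹ (ℕ.≰⇒> 2≰k)))))

  -- The sets `D H T k` partition the dimension pairs by their larger entry, so their sizes add up
  -- to the total.
  length-dimensionPairs : ∀ T α → (∀ k → length (D H T k) ≡ lookup α k) →
    length (dimensionPairs H T) ≡ degree α
  length-dimensionPairs T α D≡ = trans
    (sym (degree-fibreSizes proj₂ (dimensionPairs H T)))
    (cong degree sizes)
    where
    sizes : fibreSizes proj₂ (dimensionPairs H T) ≡ α
    sizes = lookup-ext λ k → trans (lookup-fibreSizes proj₂ (dimensionPairs H T) k) (D≡ k)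

mainTheorem17 : ∀ (n : ℕ) .{{_ : NonZero n}} (H : HessenbergFunction n) →
    ∃ λ (Ψ : ∃ (𝓑 H) → ∃ (IsFilling H)) →
    (∀ (α : ∃ (𝓑 H)) → ∃! _≡_ (λ (ℓ : Leaf H) → leafLabel H ℓ ≡ proj₁ α)) ×
    (∀ (α : ∃ (𝓑 H)) (ℓ : Leaf H) →
    leafLabel H ℓ ≡ proj₁ α → proj₁ (Ψ α) ≡ wordAbove H ℓ) ×
    (∀ (r : ℕ) (α : ∃ (𝓑 H)) →
    degree (proj₁ α) ≡ r → length (dimensionPairs H (proj₁ (Ψ α))) ≡ r) ×
    (∀ (α : ∃ (𝓑 H)) → Φ H (proj₁ (Ψ α)) ≡ proj₁ α) ×
    (∀ (α : ∃ (𝓑 H)) (k : Fin n) → 2 ≤ val k →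
    length (D H (proj₁ (Ψ α)) k) ≡ lookup (proj₁ α) k)
mainTheorem17 n@(ℕ.suc m) H =
    (λ α → word H (vertex α) , word-isFilling H (vertex α))
  , (λ α → below (vertex α) , label α ,
       λ {ℓ} ℓ-label → leafLabel-injective H (below (vertex α)) ℓ (trans (label α) (sym ℓ-label)))
  , (λ α ℓ ℓ-label → cong (wordAbove H)
       (leafLabel-injective H (below (vertex α)) ℓ (trans (label α) (sym ℓ-label))))
  , (λ r α deg → trans (length-dimensionPairs H (word H (vertex α)) (proj₁ α) (length-D α)) deg)
  , (λ α → Φ-≡ H (word H (vertex α)) (proj₁ α) (proj₂ α) (length-D α))
  , (λ α k _ → length-D α k)
  where
  vertex : ∃ (𝓑 H) → Vertex H n
  -- Levels start at 1, so running `vertexOf` with `m` ends at Level `ℕ.suc m`, which is `n`.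
  vertex (α , α∈) = proj₁ (vertexOf H α α∈ m ℕ.≤-refl)
  exponents : ∀ α k → lookup (pathProduct H (vertex α)) k ≡ lookup (proj₁ α) k
  exponents (α , α∈) k = proj₂ (vertexOf H α α∈ m ℕ.≤-refl) k (F.toℕ<n k)
  label : ∀ α → leafLabel H (below (vertex α)) ≡ proj₁ α
  label α = trans (leafLabel-below H (vertex α)) (lookup-ext (exponents α))
  length-D : ∀ α k → length (D H (word H (vertex α)) k) ≡ lookup (proj₁ α) k
  length-D α k = trans (length-D-word H (vertex α) k (F.toℕ<n k)) (exponents α k)
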